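{- Let $I$ be a countable index set and $(M_i)_{i\in I}$ countable $L$-structures, and let $M=\prod_{i\in I}M_i$, viewed as a two-sorted structure in the Feferman–Vaught language: one sort is the product $\prod_i M_i$, the other is the Boolean algebra $\mathcal P(I)$ with its Boolean operations, and for each $L$-formula $\phi(x_1,\dots,x_n)$ there is a function $[\phi]:(\prod_i M_i)^n\to\mathcal P(I)$ with $[\phi](a_1,\dots,a_n)=\{i\in I: M_i\models\phi(a_1(i),\dots,a_n(i))\}$. Equip $\prod_i M_i$ with the product topology of the discrete spaces $M_i$ (a Polish space). Then every equivalence relation on $(\prod_i M_i)^n$ that is definable without parameters in this structure is smooth.
   Context: An equivalence relation $E$ on a standard Borel space $Z$ is smooth if there is a Borel map $\theta$ from $Z$ into a Polish space with $x\,E\,y\iff\theta(x)=\theta(y)$. -}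

module Defs where

open import Level using (Level; 0ℓ; _⊔_) renaming (suc to lsuc)
open import Data.Fin.Base using (Fin)
open import Data.Nat.Base using (ℕ; suc; _+_) renaming (_≤_ to _≤ℕ_)
open import Data.Product.Base using (Σ-syntax; ∃-syntax; _×_; _,_)
open import Data.Rational.Base as ℚ using (ℚ; 0ℚ; 1ℚ)
import Data.Rational.Properties as ℚₚ
open import Data.Unit.Polymorphic.Base using (⊤)
open import Data.Vec.Base as Vec using (Vec)
open import Data.Vec.Functional as Vector using (Vector)
open import Function.Base using (_∘_)
open import Function.Bundles using (_⇔_; _↣_; Func)
open import Relation.Binary.Bundles using (Setoid)
open import Relation.Binary.Core using (Rel)
open import Relation.Binary.Definitions using (_Respects_)
open import Relation.Binary.PropositionalEquality using (_≡_; refl; subst; setoid)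
open import Relation.Nullary using (¬_; yes; no; contradiction)
open import Relation.Unary using (Pred; _∈_; _⊆_; _≐_; _∩_; _∪_; ∁; ∅; U; ⋃; _⊢_; Satisfiable)

private
  1ℓ : Level
  1ℓ = lsuc 0ℓ

-- Finite or countably infinite.
Countable : Set → Set
Countable A = A ↣ ℕ

------------------------------------------------------------------------
-- Real numbers

-- Dedekind cuts given by their upper half: `cut x q` means x < q.  One half
-- determines the other in the presence of excluded middle.
record ℝ : Set₁ where
  field
    cut       : Pred ℚ 0ℓ
    inhabited : ∃[ q ] cut q
    proper    : ∃[ q ] ¬ cut q
    upward    : ∀ {p q} → p ℚ.≤ q → cut p → cut q
    open-cut  : ∀ {q} → cut q → ∃[ p ] p ℚ.< q × cut p

open ℝ public

infix 4 _≤ℝ_ _≃ℝ_ _<ℚ_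
infixl 6 _+ℝ_

_<ℚ_ : ℝ → ℚ → Set
x <ℚ q = cut x q

_≤ℝ_ : Rel ℝ 0ℓ
x ≤ℝ y = cut y ⊆ cut x

_≃ℝ_ : Rel ℝ 0ℓ
x ≃ℝ y = x ≤ℝ y × y ≤ℝ x

0ℝ : ℝ
0ℝ = record
  { cut       = 0ℚ ℚ.<_
  ; inhabited = 1ℚ , ℚₚ.positive⁻¹ 1ℚ
  ; proper    = 0ℚ , ℚₚ.<-irrefl refl
  ; upward    = λ p≤q 0<p → ℚₚ.<-≤-trans 0<p p≤q
  ; open-cut  = λ 0<q → let p , 0<p , p<q = ℚₚ.<-dense 0<q in p , p<q , 0<p
  }

_+ℝ_ : ℝ → ℝ → ℝ
x +ℝ y = record
  { cut       = λ q → ∃[ r ] ∃[ s ] cut x r × cut y s × r ℚ.+ s ℚ.≤ q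
  ; inhabited = let r , xr = inhabited x
                    s , ys = inhabited y
                in r ℚ.+ s , r , s , xr , ys , ℚₚ.≤-refl
  ; proper    = let p , ¬xp = proper x
                    q , ¬yq = proper y
                in p ℚ.+ q , λ (r , s , xr , ys , r+s≤p+q) →
                     ℚₚ.<-irrefl refl
                       (ℚₚ.<-≤-trans (ℚₚ.+-mono-< (below x ¬xp xr) (below y ¬yq ys)) r+s≤p+q)
  ; upward    = λ p≤q (r , s , xr , ys , r+s≤p) → r , s , xr , ys , ℚₚ.≤-trans r+s≤p p≤q
  ; open-cut  = λ (r , s , xr , ys , r+s≤q) →
                  let r′ , r′<r , xr′ = open-cut x xr
                  in r′ ℚ.+ s
                   , ℚₚ.<-≤-trans (ℚₚ.+-monoˡ-< s r′<r) r+s≤q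
                   , r′ , s , xr′ , ys , ℚₚ.≤-refl
  }
  where
  below : ∀ z {p q} → ¬ cut z p → cut z q → p ℚ.< q
  below z {p} {q} ¬zp zq with q ℚₚ.≤? p
  ... | yes q≤p = contradiction (upward z q≤p zq) ¬zp
  ... | no  q≰p = ℚₚ.≰⇒> q≰p

------------------------------------------------------------------------
-- Topological spaces

-- Points form a setoid, so that products carry pointwise equality.
record TopologicalSpace : Set₂ where
  field
    points : Setoid 0ℓ 0ℓ
  open Setoid points public using (Carrier; _≈_)
  field
    Open   : Pred (Pred Carrier 0ℓ) 1ℓ
    Open-≈ : ∀ {A} → Open A → A Respects _≈_
    Open-≐ : ∀ {A B} → A ≐ B → Open A → Open B
    Open-U : Open U
    Open-∩ : ∀ {A B} → Open A → Open B → Open (A ∩ B)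
    Open-⋃ : ∀ (J : Set) (A : J → Pred Carrier 0ℓ) → (∀ j → Open (A j)) → Open (⋃ J A)

discrete : Set → TopologicalSpace
discrete X = record
  { points = setoid X
  ; Open   = λ _ → ⊤
  ; Open-≈ = λ {A} _ x≡y → subst A x≡y
  ; Open-≐ = λ _ _ → _
  ; Open-U = _
  ; Open-∩ = λ _ _ → _
  ; Open-⋃ = λ _ _ _ → _
  }

-- The topology generated by a subbasis.
data Generated {X : Set} (S : Pred (Pred X 0ℓ) 1ℓ) : Pred (Pred X 0ℓ) 1ℓ where
  subbasic : ∀ {A} → S A → Generated S A
  resp     : ∀ {A B} → A ≐ B → Generated S A → Generated S B
  whole    : Generated S U
  inter    : ∀ {A B} → Generated S A → Generated S B → Generated S (A ∩ B)
  union    : ∀ (J : Set) (A : J → Pred X 0ℓ) → (∀ j → Generated S (A j)) → Generated S (⋃ J A)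

module _ (I : Set) (X : I → TopologicalSpace) where

  private module X (i : I) = TopologicalSpace (X i)

  Π-setoid : Setoid 0ℓ 0ℓ
  Π-setoid = record
    { Carrier       = ∀ i → X.Carrier i
    ; _≈_           = λ x y → ∀ i → X._≈_ i (x i) (y i)
    ; isEquivalence = record
      { refl  = λ i → Setoid.refl (X.points i)
      ; sym   = λ p i → Setoid.sym (X.points i) (p i)
      ; trans = λ p q i → Setoid.trans (X.points i) (p i) (q i)
      }
    }

  -- Preimages of open sets under the coordinate projections.
  data Cylinder : Pred (Pred (∀ i → X.Carrier i) 0ℓ) 1ℓ where
    cylinder : ∀ i {A} → X.Open i A → Cylinder (λ x → x i ∈ A)

  Π-space : TopologicalSpace
  Π-space = record
    { points = Π-setoid
    ; Open   = Generated Cylinder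
    ; Open-≈ = respects
    ; Open-≐ = resp
    ; Open-U = whole
    ; Open-∩ = inter
    ; Open-⋃ = union
    }
    where
    respects : ∀ {A} → Generated Cylinder A → A Respects Setoid._≈_ Π-setoid
    respects (subbasic (cylinder i o)) x≈y = X.Open-≈ i o (x≈y i)
    respects (resp (A⊆B , B⊆A) g) x≈y      = A⊆B ∘ respects g x≈y ∘ B⊆A
    respects whole x≈y                     = λ _ → _
    respects (inter g h) x≈y (a , b)       = respects g x≈y a , respects h x≈y b
    respects (union J A g) x≈y (j , a)     = j , respects (g j) x≈y a

------------------------------------------------------------------------
-- Polish spaces

record Metric (S : Setoid 0ℓ 0ℓ) : Set₁ where
  open Setoid S using (Carrier; _≈_)
  field
    dist     : Carrier → Carrier → ℝ
    nonneg   : ∀ x y → 0ℝ ≤ℝ dist x y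
    zero-iff : ∀ x y → dist x y ≃ℝ 0ℝ ⇔ x ≈ y
    symm     : ∀ x y → dist x y ≃ℝ dist y x
    triangle : ∀ x y z → dist x z ≤ℝ dist x y +ℝ dist y z

  MetricOpen : Pred (Pred Carrier 0ℓ) 0ℓ
  MetricOpen A = ∀ x → x ∈ A → ∃[ ε ] 0ℚ ℚ.< ε × (∀ y → dist x y <ℚ ε → y ∈ A)

  Cauchy : Pred (ℕ → Carrier) 0ℓ
  Cauchy s = ∀ ε → 0ℚ ℚ.< ε → ∃[ N ] ∀ m n → N ≤ℕ m → N ≤ℕ n → dist (s m) (s n) <ℚ ε

  _ConvergesTo_ : (ℕ → Carrier) → Carrier → Set
  s ConvergesTo x = ∀ ε → 0ℚ ℚ.< ε → ∃[ N ] ∀ n → N ≤ℕ n → dist (s n) x <ℚ ε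

  Complete : Set
  Complete = ∀ s → Cauchy s → ∃[ x ] s ConvergesTo x

module _ (X : TopologicalSpace) where
  open TopologicalSpace X

  CompletelyMetrizable : Set₁
  CompletelyMetrizable =
    Σ[ d ∈ Metric points ] Metric.Complete d × (∀ A → Open A ⇔ Metric.MetricOpen d A)

  Separable : Set₁
  Separable =
    Σ[ D ∈ Set ] Countable D × Σ[ f ∈ (D → Carrier) ]
      (∀ A → Open A → Satisfiable A → ∃[ c ] f c ∈ A)

  IsPolish : Set₁
  IsPolish = Separable × CompletelyMetrizable

record PolishSpace : Set₂ where
  field
    space    : TopologicalSpace
    isPolish : IsPolish space
  open TopologicalSpace space public

------------------------------------------------------------------------
-- Borel sets, Borel maps and smoothness

data IsBorel (X : TopologicalSpace) : Pred (Pred (TopologicalSpace.Carrier X) 0ℓ) 1ℓ where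
  open-set   : ∀ {A} → TopologicalSpace.Open X A → IsBorel X A
  resp       : ∀ {A B} → A ≐ B → IsBorel X A → IsBorel X B
  complement : ∀ {A} → IsBorel X A → IsBorel X (∁ A)
  union      : ∀ (A : ℕ → Pred (TopologicalSpace.Carrier X) 0ℓ) →
               (∀ n → IsBorel X (A n)) → IsBorel X (⋃ ℕ A)

module _ (X Y : TopologicalSpace) where
  private
    module X = TopologicalSpace X
    module Y = TopologicalSpace Y

  IsBorelMap : (X.Carrier → Y.Carrier) → Set₁
  IsBorelMap θ = ∀ A → IsBorel Y A → IsBorel X (θ ⊢ A)

record Smooth {ℓ} (Z : TopologicalSpace) (E : Rel (TopologicalSpace.Carrier Z) ℓ) :
              Set (lsuc 1ℓ ⊔ ℓ) where
  field
    target     : PolishSpace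
    map        : Func (TopologicalSpace.points Z) (PolishSpace.points target)
    borel      : IsBorelMap Z (PolishSpace.space target) (Func.to map)
    classifies : ∀ x y → E x y ⇔ PolishSpace._≈_ target (Func.to map x) (Func.to map y)

------------------------------------------------------------------------
-- First-order logic

record Language : Set₁ where
  field
    FunSym : ℕ → Set
    RelSym : ℕ → Set

module _ (L : Language) where
  open Language L

  record Structure : Set₁ where
    field
      Carrier : Set
      fun     : ∀ {k} → FunSym k → Vec Carrier k → Carrier
      rel     : ∀ {k} → RelSym k → Pred (Vec Carrier k) 0ℓ

  -- Terms and formulas in n free variables; `ex` binds de Bruijn index zero.
  data Term (n : ℕ) : Set where
    var : Fin n → Term n
    fun : ∀ {k} → FunSym k → Vec (Term n) k → Term n

  data Formula (n : ℕ) : Set where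
    eq  : Term n → Term n → Formula n
    rel : ∀ {k} → RelSym k → Vec (Term n) k → Formula n
    neg : Formula n → Formula n
    and : Formula n → Formula n → Formula n
    ex  : Formula (suc n) → Formula n

module _ {L : Language} (M : Structure L) where
  private module M = Structure M

  eval  : ∀ {n} → Vector M.Carrier n → Term L n → M.Carrier
  evals : ∀ {n k} → Vector M.Carrier n → Vec (Term L n) k → Vec M.Carrier k
  eval ρ (var x)    = ρ x
  eval ρ (fun f ts) = M.fun f (evals ρ ts)
  evals ρ Vec.[]       = Vec.[]
  evals ρ (t Vec.∷ ts) = eval ρ t Vec.∷ evals ρ ts

  Sat : ∀ {n} → Formula L n → Vector M.Carrier n → Set
  Sat (eq s t)   ρ = eval ρ s ≡ eval ρ t
  Sat (rel r ts) ρ = M.rel r (evals ρ ts)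
  Sat (neg φ)    ρ = ¬ Sat φ ρ
  Sat (and φ ψ)  ρ = Sat φ ρ × Sat ψ ρ
  Sat (ex φ)     ρ = ∃[ a ] Sat φ (a Vector.∷ ρ)

------------------------------------------------------------------------
-- The Feferman–Vaught language

-- m counts the free variables of the product sort, s those of the sort of
-- subsets of the index set.  The only terms of the product sort are variables.
module _ (L : Language) where

  data SetTerm (m s : ℕ) : Set where
    var        : Fin s → SetTerm m s
    empty full : SetTerm m s
    meet join  : SetTerm m s → SetTerm m s → SetTerm m s
    compl      : SetTerm m s → SetTerm m s
    [_]        : ∀ {k} → Formula L k → Vector (Fin m) k → SetTerm m s

  data FVFormula (m s : ℕ) : Set where
    eqProd : Fin m → Fin m → FVFormula m s
    eqSet  : SetTerm m s → SetTerm m s → FVFormula m s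
    neg    : FVFormula m s → FVFormula m s
    and    : FVFormula m s → FVFormula m s → FVFormula m s
    exProd : FVFormula (suc m) s → FVFormula m s
    exSet  : FVFormula m (suc s) → FVFormula m s

module Product {L : Language} (I : Set) (M : I → Structure L) where

  ∏M : Set
  ∏M = ∀ i → Structure.Carrier (M i)

  ⟦_⟧ : ∀ {k} → Formula L k → Vector ∏M k → Pred I 0ℓ
  ⟦ φ ⟧ a i = Sat (M i) φ (λ j → a j i)

  evalSet : ∀ {m s} → Vector ∏M m → Vector (Pred I 0ℓ) s → SetTerm L m s → Pred I 0ℓ
  evalSet a X (var v)     = X v
  evalSet a X empty       = ∅
  evalSet a X full        = U
  evalSet a X (meet t u)  = evalSet a X t ∩ evalSet a X u
  evalSet a X (join t u)  = evalSet a X t ∪ evalSet a X u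
  evalSet a X (compl t)   = ∁ (evalSet a X t)
  evalSet a X ([ φ ] v)   = ⟦ φ ⟧ (a ∘ v)

  -- Equality is extensional on both sorts.
  SatFV : ∀ {m s} → FVFormula L m s → Vector ∏M m → Vector (Pred I 0ℓ) s → Set₁
  SatFV (eqProd v w) a X = Level.Lift 1ℓ (∀ i → a v i ≡ a w i)
  SatFV (eqSet t u)  a X = Level.Lift 1ℓ (evalSet a X t ≐ evalSet a X u)
  SatFV (neg φ)      a X = ¬ SatFV φ a X
  SatFV (and φ ψ)    a X = SatFV φ a X × SatFV ψ a X
  SatFV (exProd φ)   a X = Σ[ b ∈ ∏M ] SatFV φ (b Vector.∷ a) X
  SatFV (exSet φ)    a X = Σ[ Y ∈ Pred I 0ℓ ] SatFV φ a (Y Vector.∷ X)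

  -- Definability without parameters of a binary relation on n-tuples.
  Definable : ∀ {ℓ} (n : ℕ) → Rel (Vector ∏M n) ℓ → Set (1ℓ ⊔ ℓ)
  Definable n E =
    Σ[ φ ∈ FVFormula L (n + n) 0 ] (∀ x y → E x y ⇔ SatFV φ (x Vector.++ y) Vector.[])

  ∏M-space : TopologicalSpace
  ∏M-space = Π-space I (λ i → discrete (Structure.Carrier (M i)))

  power-space : ℕ → TopologicalSpace
  power-space n = Π-space (Fin n) (λ _ → ∏M-space)

{-# OPTIONS --safe #-}

-- By the Feferman–Vaught method, the truth of a formula at a tuple a depends
-- only on a finite colouring of I, where the colour of i depends on i and a(i)
-- alone, and more precisely only on the number of indices of each colour,
-- counted up to a threshold N.
--
-- Apply this to a definable equivalence relation E.  The E-saturation of a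
-- basic clopen set s is again given by an existential quantifier over a
-- determined relation, so it is a Boolean combination of the open conditions
-- "the colour κ occurs at least r times", hence Borel.  Let θ(x) record which
-- saturations contain x.  If θ(x) = θ(x′), let W be the union of the two
-- classes and shrink a basic clopen set s meeting W until each of the finitely
-- many open conditions that decide E(x, –) is constant on W ∩ s.  Both classes
-- meet s, so one point of s that is E-equivalent to x makes every point of
-- W ∩ s equivalent to x, among them one equivalent to x′.
module Submission where

open import Defs
open import Level using (Level; 0ℓ; lift; lower) renaming (suc to lsuc)
open import Axiom.ExcludedMiddle using (ExcludedMiddle)
open import Data.Bool.Base using (Bool; true; false; not; if_then_else_)
open import Data.Bool.Properties using (¬-not; not-¬) renaming (_≟_ to _≟ᵇ_)
open import Data.Empty using (⊥)
open import Data.Fin.Base using (Fin; zero; suc; splitAt)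
import Data.Fin.Properties as Finₚ
open import Data.Integer.Base using (+_; +<+; -[1+_])
open import Data.List.Base using (List; []; _∷_; length; filter; map; take; _++_; cartesianProduct; allFin; upTo)
open import Data.List.Membership.Propositional using (_∈_; _∉_; find)
open import Data.List.Membership.Propositional.Properties using (∈-filter⁺; ∈-filter⁻; ∈-++⁺ˡ; ∈-++⁺ʳ; ∈-map⁺; ∈-cartesianProduct⁺; ∈-allFin; ∈-upTo⁺)
open import Data.List.Properties using (length-filter; ∷-injectiveˡ; ∷-injectiveʳ; length-take; filter-notAll; length-map; map-∘; length-++; map-cong)
open import Data.List.Relation.Unary.All as All using (All; []; _∷_)
import Data.List.Relation.Unary.All.Properties as Allₚ
open import Data.List.Relation.Unary.AllPairs using ([]; _∷_)
open import Data.List.Relation.Unary.Any as Any using (Any; here; there)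
open import Data.List.Relation.Unary.Unique.Propositional using (Unique)
import Data.List.Relation.Unary.Unique.Propositional.Properties as Uniqueₚ
open import Data.Nat.Base using (ℕ; zero; suc; _+_; _*_; _≤_; _<_; z≤n; s≤s; s<s⁻¹; _⊓_; _⊔_)
open import Data.Nat.Coprimality using (1-coprimeTo)
open import Data.Nat.Properties hiding (_≟_)
open import Data.Product.Base using (Σ; ∃-syntax; Σ-syntax; _×_; _,_; proj₁; proj₂)
open import Data.Product.Function.NonDependent.Propositional using (_×-⇔_)
open import Data.Rational.Base as ℚ using (ℚ; mkℚ; 0ℚ; 1ℚ; *<*)
import Data.Rational.Properties as ℚₚ
open import Data.Sum.Base using (_⊎_; inj₁; inj₂)
open import Data.Sum.Function.Propositional using (_⊎-⇔_)
open import Data.Vec.Base as Vec using (Vec; lookup; tabulate)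
open import Data.Vec.Functional as Vector using (Vector)
import Data.Vec.Properties as Vecₚ
open import Function.Base using (_∘_; id; case_of_)
open import Function.Bundles using (_⇔_; mk⇔; Equivalence; mk↣; Injection)
open import Function.Properties.Equivalence using () renaming (refl to ⇔-refl)
open import Relation.Binary.Core using (Rel)
open import Relation.Binary.PropositionalEquality hiding (resp; [_])
open import Relation.Binary.Structures using (IsEquivalence)
open import Relation.Nullary using (¬_; Dec; yes; no; contradiction; does)
open import Relation.Nullary.Decidable using (map′; ¬?; dec-true; decidable-stable; from-yes)
open import Relation.Unary using (Pred; Decidable; _⊆_; _∩_; _∪_; ∁; ∅; U; ⋃; Satisfiable)

open Equivalence using (to; from)

-- Lengths of filtered lists

length-filter-split : {A : Set} {P : Pred A 0ℓ} (P? : Decidable P) (xs : List A) →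
                      length (filter P? xs) + length (filter (¬? ∘ P?) xs) ≡ length xs
length-filter-split P? [] = refl
length-filter-split P? (x ∷ xs) with P? x
... | yes _ = cong suc (length-filter-split P? xs)
... | no  _ = trans (+-suc _ _) (cong suc (length-filter-split P? xs))

length-filter-map : {A B K : Set} (k : K) (_≟_ : (k k′ : K) → Dec (k ≡ k′)) {f : A → K} {g : B → K}
  (xs : List A) (ys : List B) → map f xs ≡ map g ys →
  length (filter (λ x → f x ≟ k) xs) ≡ length (filter (λ y → g y ≟ k) ys)
length-filter-map k _≟_ [] [] e = refl
length-filter-map k _≟_ {f} {g} (x ∷ xs) (y ∷ ys) e with f x ≟ k | g y ≟ k
... | yes _ | yes _ = cong suc (length-filter-map k _≟_ xs ys (∷-injectiveʳ e))
... | no _  | no _  = length-filter-map k _≟_ xs ys (∷-injectiveʳ e)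
... | yes p | no ¬q = contradiction (trans (sym (∷-injectiveˡ e)) p) ¬q
... | no ¬p | yes q = contradiction (trans (∷-injectiveˡ e) q) ¬p

-- Counting colours up to a threshold

-- Each bit added to a colouring halves the threshold up to which counts agree.
room : ℕ → ℕ → ℕ
room zero    N = N
room (suc q) N = room q N + room q N

module Classical (em : ExcludedMiddle 0ℓ) where

  _≟_ : {A : Set} (x y : A) → Dec (x ≡ y)
  x ≟ y = em

  length-mono-⊆ : {A : Set} {xs ys : List A} → Unique xs → (∀ {x} → x ∈ xs → x ∈ ys) →
                  length xs ≤ length ys
  length-mono-⊆ [] _ = z≤n
  length-mono-⊆ {xs = x ∷ xs} {ys} (x∉xs ∷ u) xs⊆ys = ≤-trans
    (s≤s (length-mono-⊆ u λ z∈xs →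
      ∈-filter⁺ x≢? (xs⊆ys (there z∈xs)) (All.lookup x∉xs z∈xs)))
    (filter-notAll x≢? ys (Any.map (λ x≡z x≢z → x≢z x≡z) (xs⊆ys (here refl))))
    where
    x≢? : Decidable (x ≢_)
    x≢? z = ¬? (x ≟ z)

  -- A cardinality bound witnessed by a duplicate-free list makes sense for infinite `A` too; the
  -- inequality on the length makes it antitone in `n` at once.
  AtLeast : {I : Set} → ℕ → Pred I 0ℓ → Set
  AtLeast n A = ∃[ xs ] Unique xs × All A xs × n ≤ length xs

  module _ {I : Set} where

    AtLeast-mono : ∀ {m n} {A B : Pred I 0ℓ} → m ≤ n → A ⊆ B → AtLeast n A → AtLeast m B
    AtLeast-mono m≤n A⊆B (xs , u , xs⊆A , n≤) = xs , u , All.map A⊆B xs⊆A , ≤-trans m≤n n≤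

    AtLeast-exactly : ∀ {n} {A : Pred I 0ℓ} → AtLeast n A →
                      ∃[ xs ] Unique xs × All A xs × length xs ≡ n
    AtLeast-exactly {n} (xs , u , xs⊆A , n≤) =
      take n xs , Uniqueₚ.take⁺ n u , Allₚ.take⁺ n xs⊆A ,
      trans (length-take n xs) (m≤n⇒m⊓n≡m n≤)

    AtLeast-+ : ∀ {m n} {A B C : Pred I 0ℓ} → A ⊆ C → B ⊆ C → (∀ {i} → A i → ¬ B i) →
                AtLeast m A → AtLeast n B → AtLeast (m + n) C
    AtLeast-+ A⊆C B⊆C disj (xs , u , xs⊆A , m≤) (ys , v , ys⊆B , n≤) =
      xs ++ ys ,
      Uniqueₚ.++⁺ u v (λ (z∈xs , z∈ys) → disj (All.lookup xs⊆A z∈xs) (All.lookup ys⊆B z∈ys)) ,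
      Allₚ.++⁺ (All.map A⊆C xs⊆A) (All.map B⊆C ys⊆B) ,
      subst (_ ≤_) (sym (length-++ xs)) (+-mono-≤ m≤ n≤)

    -- Of `m + n` distinct points of `A`, filtering out `P` loses at most `m`.
    AtLeast-∖ : ∀ {m n} {A P : Pred I 0ℓ} → ¬ AtLeast (suc m) (λ i → A i × P i) →
                AtLeast (m + n) A → AtLeast n (λ i → A i × ¬ P i)
    AtLeast-∖ {m} {n} {A} {P} few (xs , u , xs⊆A , m+n≤) =
      filter (¬? ∘ P?) xs , Uniqueₚ.filter⁺ (¬? ∘ P?) u , part (¬? ∘ P?) ,
      +-cancelˡ-≤ m _ _ (≤-trans m+n≤ (subst (_≤ m + length (filter (¬? ∘ P?) xs))
        (length-filter-split P? xs) (+-monoˡ-≤ _ small)))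
      where
      P? : Decidable P
      P? i = em
      part : ∀ {Q : Pred I 0ℓ} (Q? : Decidable Q) → All (λ i → A i × Q i) (filter Q? xs)
      part Q? = All.tabulate λ z∈ →
        let z∈xs , q = ∈-filter⁻ Q? {xs = xs} z∈ in All.lookup xs⊆A z∈xs , q
      small : length (filter P? xs) ≤ m
      small = ≮⇒≥ λ m< → few (filter P? xs , Uniqueₚ.filter⁺ P? u , part P? , m<)

    AtLeast-list : ∀ {n} {A : Pred I 0ℓ} {xs : List I} → A ⊆ (_∈ xs) → AtLeast n A → n ≤ length xs
    AtLeast-list A⊆xs (ys , u , ys⊆A , n≤) =
      ≤-trans n≤ (length-mono-⊆ u (A⊆xs ∘ All.lookup ys⊆A))

    maximal-size : ∀ N {A : Pred I 0ℓ} → ¬ AtLeast N A →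
                   ∃[ n ] n < N × AtLeast n A × ¬ AtLeast (suc n) A
    maximal-size zero    ¬al = contradiction ([] , [] , [] , z≤n) ¬al
    maximal-size (suc N) {A} ¬al with em {AtLeast N A}
    ... | yes al = N , n<1+n N , al , ¬al
    ... | no ¬al′ = let n , n<N , rest = maximal-size N ¬al′ in n , m<n⇒m<1+n n<N , rest

    -- Cardinalities capped at `N` agree: min(|A|, N) = min(|B|, N).
    _⇔[_]_ : Pred I 0ℓ → ℕ → Pred I 0ℓ → Set
    A ⇔[ N ] B = ∀ n → n ≤ N → (AtLeast n A → AtLeast n B) × (AtLeast n B → AtLeast n A)

    _∣_≡_ : Pred I 0ℓ → (I → Bool) → Bool → Pred I 0ℓ
    (A ∣ y ≡ b) i = A i × y i ≡ b

    -- One back-and-forth move: a splitting of `A` in two is answered by a splitting of `A′`.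
    Refinement : ℕ → Pred I 0ℓ → Pred I 0ℓ → (I → Bool) → Set
    Refinement N A A′ y = ∃[ y′ ] ∀ b → (A ∣ y ≡ b) ⇔[ N ] (A′ ∣ y′ ≡ b)

    module _ {N : ℕ} {A A′ : Pred I 0ℓ} (A⇔A′ : A ⇔[ N + N ] A′) (y : I → Bool) where

      -- Give colour b₀ to exactly as many points of A′ as of A; the counts of the
      -- other colour then agree by subtraction, which needs agreement up to N + N.
      refine-few : ∀ b₀ → ¬ AtLeast N (A ∣ y ≡ b₀) → Refinement N A A′ y
      refine-few b₀ ¬al with n , n<N , al , max ← maximal-size N ¬al
                        with ys , u , ys⊆A′ , len ← AtLeast-exactly
                               (proj₁ (A⇔A′ n (≤-trans (<⇒≤ n<N) (m≤m+n N N)))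
                                 (AtLeast-mono ≤-refl proj₁ al)) = y′ , λ b → case b ≟ᵇ b₀ of λ
        { (yes refl) → λ k k≤N → (λ al′ → AtLeast-mono (small al′) id inside) ,
                                 λ al′ → AtLeast-mono (small′ al′) id al
        ; (no b≢b₀) → subst (λ b → (A ∣ y ≡ b) ⇔[ N ] (A′ ∣ y′ ≡ b)) (sym (¬-not b≢b₀)) λ k k≤N →
            (λ al′ → AtLeast-mono ≤-refl (λ (a , y≢) → a , ¬-not y≢)
               (AtLeast-∖ (λ al″ → 1+n≰n (small′ al″)) (proj₁ (A⇔A′ (n + k) (bound k≤N))
                 (AtLeast-+ proj₁ proj₁ (λ (_ , p) (_ , q) → not-¬ p q) al al′)))) ,
            (λ al′ → AtLeast-mono ≤-refl (λ (a , y≢) → a , ¬-not y≢)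
               (AtLeast-∖ max (proj₂ (A⇔A′ (n + k) (bound k≤N))
                 (AtLeast-+ proj₁ proj₁ (λ (_ , p) (_ , q) → not-¬ p q) inside al′))))
        }
        where
        y′ : I → Bool
        y′ i = if does (em {i ∈ ys}) then b₀ else not b₀
        ∈⇒y′ : ∀ {i} → i ∈ ys → y′ i ≡ b₀
        ∈⇒y′ {i} i∈ys with em {i ∈ ys}
        ... | yes _  = refl
        ... | no i∉ys = contradiction i∈ys i∉ys
        y′⇒∈ : ∀ {i} → y′ i ≡ b₀ → i ∈ ys
        y′⇒∈ {i} e with em {i ∈ ys}
        ... | yes i∈ys = i∈ys
        ... | no _     = contradiction (sym e) (not-¬ refl)
        inside : AtLeast n (A′ ∣ y′ ≡ b₀)
        inside = ys , u , All.tabulate (λ i∈ → All.lookup ys⊆A′ i∈ , ∈⇒y′ i∈) ,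
                 ≤-reflexive (sym len)
        bound : ∀ {k} → k ≤ N → n + k ≤ N + N
        bound = +-mono-≤ (<⇒≤ n<N)
        small : ∀ {k} → AtLeast k (A ∣ y ≡ b₀) → k ≤ n
        small al′ = ≮⇒≥ λ n<k → max (AtLeast-mono n<k id al′)
        small′ : ∀ {k} → AtLeast k (A′ ∣ y′ ≡ b₀) → k ≤ n
        small′ al′ = subst (_ ≤_) len (AtLeast-list (y′⇒∈ ∘ proj₂) al′)

      -- `A` has at least `N + N` points, hence so has `A′`. Half of a list of that many gets one
      -- colour, everything else the other; counts beyond `N` are not compared.
      refine-many : (∀ b → AtLeast N (A ∣ y ≡ b)) → Refinement N A A′ y
      refine-many al with ys , u , ys⊆A′ , len ← AtLeast-exactly (proj₁ (A⇔A′ (N + N) ≤-refl)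
                            (AtLeast-+ proj₁ proj₁ (λ { (_ , p) (_ , q) → case trans (sym p) q of λ () })
                              (al true) (al false))) =
        y′ , λ b n n≤N → (λ _ → AtLeast-mono n≤N id (inside b)) , λ _ → AtLeast-mono n≤N id (al b)
        where
        ys₁ = take N ys
        y′ : I → Bool
        y′ i = does (em {i ∈ ys₁})
        ∈⇒y′ : ∀ {i} → i ∈ ys₁ → y′ i ≡ true
        ∈⇒y′ {i} i∈ys with em {i ∈ ys₁}
        ... | yes _  = refl
        ... | no i∉ys = contradiction i∈ys i∉ys
        y′⇒∈ : ∀ {i} → y′ i ≡ true → i ∈ ys₁
        y′⇒∈ {i} e with em {i ∈ ys₁}
        ... | yes i∈ys = i∈ys
        len₁ : length ys₁ ≡ N
        len₁ = trans (length-take N ys) (trans (cong (N ⊓_) len) (m≤n⇒m⊓n≡m (m≤m+n N N)))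
        inside : ∀ b → AtLeast N (A′ ∣ y′ ≡ b)
        inside true = ys₁ , Uniqueₚ.take⁺ N u ,
          All.zip (Allₚ.take⁺ N ys⊆A′ , All.tabulate ∈⇒y′) , ≤-reflexive (sym len₁)
        inside false = AtLeast-mono ≤-refl (λ (a , ≢t) → a , ¬-not ≢t)
          (AtLeast-∖ (λ al′ → 1+n≰n (subst (_ ≤_) len₁ (AtLeast-list (y′⇒∈ ∘ proj₂) al′)))
            (ys , u , ys⊆A′ , ≤-reflexive (sym len)))

      refine : Refinement N A A′ y
      refine with em {AtLeast N (A ∣ y ≡ true)} | em {AtLeast N (A ∣ y ≡ false)}
      ... | no ¬al | _      = refine-few true ¬al
      ... | yes _  | no ¬al = refine-few false ¬al
      ... | yes p  | yes q  = refine-many λ { true → p ; false → q }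

    -- A colour-preserving injection of every set of at most N indices.  Unlike the
    -- equivalent condition on fibres, this is visibly inherited by coarser colourings.
    _≲[_]_ : {K : Set} → (I → K) → ℕ → (I → K) → Set
    w ≲[ N ] w′ = ∀ xs → Unique xs → length xs ≤ N → ∃[ ys ] Unique ys × map w xs ≡ map w′ ys

    _∼[_]_ : {K : Set} → (I → K) → ℕ → (I → K) → Set
    w ∼[ N ] w′ = w ≲[ N ] w′ × w′ ≲[ N ] w

    module _ {K : Set} where

      fibre : (I → K) → K → Pred I 0ℓ
      fibre w k i = w i ≡ k

      ≲-fibres : ∀ {N} {w w′ : I → K} →
                 (∀ k n → n ≤ N → AtLeast n (fibre w k) → AtLeast n (fibre w′ k)) → w ≲[ N ] w′
      ≲-fibres fib [] _ _ = [] , [] , refl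
      ≲-fibres {N} {w} {w′} fib (x ∷ xs) (x∉xs ∷ u) len
        with ys , v , e ← ≲-fibres {N} {w} {w′} fib xs u (<⇒≤ len)
        with zs , t , zs⊆k , n≤ ← fib (w x) (suc (length (filter (λ i → w i ≟ w x) xs)))
               (≤-trans (s≤s (length-filter (λ i → w i ≟ w x) xs)) len)
               (x ∷ filter (λ i → w i ≟ w x) xs ,
                All.tabulate (λ z∈ → All.lookup x∉xs
                  (proj₁ (∈-filter⁻ (λ i → w i ≟ w x) {xs = xs} z∈)))
                  ∷ Uniqueₚ.filter⁺ (λ i → w i ≟ w x) u ,
                refl ∷ Allₚ.all-filter (λ i → w i ≟ w x) xs , ≤-refl)
        with em {Any (_∉ ys) zs}
      ... | yes any = let z , z∈zs , z∉ys = find any in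
            z ∷ ys , All.tabulate (λ { i∈ys refl → z∉ys i∈ys }) ∷ v ,
            cong₂ _∷_ (sym (All.lookup zs⊆k z∈zs)) e
      -- If every candidate in `zs` were used, they would all lie among the members of `ys` of this
      -- colour, which are only as many as the members of `xs` of this colour.
      ... | no none = contradiction
              (≤-trans n≤ (length-mono-⊆ t λ z∈zs →
                ∈-filter⁺ (λ i → w′ i ≟ w x)
                  (decidable-stable em (All.lookup (Allₚ.¬Any⇒All¬ zs none) z∈zs))
                  (All.lookup zs⊆k z∈zs)))
              (subst (λ l → ¬ suc (length (filter (λ i → w i ≟ w x) xs)) ≤ l)
                (length-filter-map (w x) _≟_ xs ys e) 1+n≰n)

      fibres-≲ : ∀ {N} {w w′ : I → K} → w ≲[ N ] w′ →
                 ∀ k n → n ≤ N → AtLeast n (fibre w k) → AtLeast n (fibre w′ k)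
      fibres-≲ {w = w} {w′} w≲w′ k n n≤N al
        with xs , u , xs⊆k , refl ← AtLeast-exactly al
        with ys , v , e ← w≲w′ xs u n≤N =
          ys , v , Allₚ.map⁻ (subst (All (_≡ k)) e (Allₚ.map⁺ xs⊆k)) ,
          ≤-reflexive (trans (sym (length-map w xs)) (trans (cong length e) (length-map w′ ys)))

      ∼-fibres : ∀ {N} {w w′ : I → K} → (∀ k → fibre w k ⇔[ N ] fibre w′ k) → w ∼[ N ] w′
      ∼-fibres fib = ≲-fibres (λ k n n≤N → proj₁ (fib k n n≤N)) ,
                     ≲-fibres (λ k n n≤N → proj₂ (fib k n n≤N))

      ≲-mono : ∀ {M N} {w w′ : I → K} → M ≤ N → w ≲[ N ] w′ → w ≲[ M ] w′
      ≲-mono M≤N w≲w′ xs u len = w≲w′ xs u (≤-trans len M≤N)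

      ∼-mono : ∀ {M N} {w w′ : I → K} → M ≤ N → w ∼[ N ] w′ → w ∼[ M ] w′
      ∼-mono M≤N (p , q) = ≲-mono M≤N p , ≲-mono M≤N q

      ∼-reflexive : ∀ {N} {w w′ : I → K} → (∀ i → w i ≡ w′ i) → w ∼[ N ] w′
      ∼-reflexive e = (λ xs u _ → xs , u , map-cong e xs) ,
                       (λ xs u _ → xs , u , map-cong (sym ∘ e) xs)

      -- At threshold 1 every colour occurring in `w` occurs in `w′`; universal statements over the
      -- indices transfer this way.
      ≲-point : ∀ {N} {w w′ : I → K} → 1 ≤ N → w ≲[ N ] w′ → ∀ i → ∃[ j ] w i ≡ w′ j
      ≲-point 1≤N w≲w′ i with w≲w′ (i ∷ []) ([] ∷ []) 1≤N
      ... | j ∷ [] , _ , e = j , ∷-injectiveˡ e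

    ≲-map : ∀ {J K : Set} {N} (f : J → K) {w w′ : I → J} {v v′ : I → K} →
            (∀ i → f (w i) ≡ v i) → (∀ i → f (w′ i) ≡ v′ i) → w ≲[ N ] w′ → v ≲[ N ] v′
    ≲-map f {w} {w′} fw fw′ w≲w′ xs u len with ys , t , e ← w≲w′ xs u len = ys , t , (begin
      map _ xs         ≡⟨ map-cong fw xs ⟨
      map (f ∘ w) xs   ≡⟨ map-∘ xs ⟩
      map f (map w xs) ≡⟨ cong (map f) e ⟩
      map f (map w′ ys) ≡⟨ map-∘ ys ⟨
      map (f ∘ w′) ys  ≡⟨ map-cong fw′ ys ⟩
      map _ ys         ∎)
      where open ≡-Reasoning

    ∼-map : ∀ {J K : Set} {N} (f : J → K) {w w′ : I → J} {v v′ : I → K} →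
            (∀ i → f (w i) ≡ v i) → (∀ i → f (w′ i) ≡ v′ i) → w ∼[ N ] w′ → v ∼[ N ] v′
    ∼-map f fw fw′ (p , q) = ≲-map f fw fw′ p , ≲-map f fw′ fw q

    -- Each fibre is refined on its own. The fibres of `w′` are disjoint, so at each index `y′` can
    -- follow the refinement belonging to that index's colour.
    extend-bit : ∀ {K : Set} {N} {w w′ : I → K} → w ∼[ N + N ] w′ → (y : I → Bool) →
                 ∃[ y′ ] (λ i → w i , y i) ∼[ N ] (λ i → w′ i , y′ i)
    extend-bit {K} {N} {w} {w′} (w≲w′ , w′≲w) y =
      (λ i → proj₁ (ref (w′ i)) i) , ∼-fibres λ (k , b) n n≤N →
        (λ al → AtLeast-mono ≤-refl (λ { (refl , refl) → refl })
          (proj₁ (proj₂ (ref k) b n n≤N) (AtLeast-mono ≤-refl (λ { refl → refl , refl }) al))) ,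
        (λ al → AtLeast-mono ≤-refl (λ { (refl , refl) → refl })
          (proj₂ (proj₂ (ref k) b n n≤N) (AtLeast-mono ≤-refl (λ { refl → refl , refl }) al)))
      where
      ref : ∀ k → Refinement N (fibre w k) (fibre w′ k) y
      ref k = refine (λ n n≤ → fibres-≲ w≲w′ k n n≤ , fibres-≲ w′≲w k n n≤) y

    extend : ∀ {K : Set} q {N} {w w′ : I → K} → w ∼[ room q N ] w′ → (v : I → Vec Bool q) →
             Σ[ v′ ∈ (I → Vec Bool q) ] (λ i → w i , v i) ∼[ N ] (λ i → w′ i , v′ i)
    extend zero w∼w′ v =
      v , ∼-map (_, Vec.[]) (λ i → cong (_ ,_) (nil (v i))) (λ i → cong (_ ,_) (nil (v i))) w∼w′
      where
      nil : (xs : Vec Bool 0) → Vec.[] ≡ xs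
      nil Vec.[] = refl
    extend (suc q) w∼w′ v
      with y′ , ∼₁ ← extend-bit w∼w′ (Vec.head ∘ v)
      with v′ , ∼₂ ← extend q ∼₁ (Vec.tail ∘ v) =
        (λ i → y′ i Vec.∷ v′ i) ,
        ∼-map (λ ((k , b) , bs) → k , b Vec.∷ bs) (λ i → cong (_ ,_) (η (v i))) (λ _ → refl) ∼₂
      where
      η : (xs : Vec Bool (suc q)) → Vec.head xs Vec.∷ Vec.tail xs ≡ xs
      η (_ Vec.∷ _) = refl

-- The Feferman–Vaught theorem

bitVectors : ∀ k → List (Vec Bool k)
bitVectors zero    = Vec.[] ∷ []
bitVectors (suc k) = map (true Vec.∷_) (bitVectors k) ++ map (false Vec.∷_) (bitVectors k)

∈-bitVectors : ∀ {k} (κ : Vec Bool k) → κ ∈ bitVectors k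
∈-bitVectors Vec.[]            = here refl
∈-bitVectors (true  Vec.∷ κ) = ∈-++⁺ˡ (∈-map⁺ _ (∈-bitVectors κ))
∈-bitVectors (false Vec.∷ κ) = ∈-++⁺ʳ _ (∈-map⁺ _ (∈-bitVectors κ))

map-fromList-injective : {A B : Set} {f g : A → B} (xs : List A) →
  Vec.map f (Vec.fromList xs) ≡ Vec.map g (Vec.fromList xs) → ∀ {x} → x ∈ xs → f x ≡ g x
map-fromList-injective (_ ∷ xs) e (here refl) = Vecₚ.∷-injectiveˡ e
map-fromList-injective (_ ∷ xs) e (there x∈) = map-fromList-injective xs (Vecₚ.∷-injectiveʳ e) x∈

tabulate-++ : ∀ {A B : Set} (f : A → B) {m n} (x : Vector A m) (y : Vector A n) →
              tabulate (f ∘ (x Vector.++ y)) ≡ tabulate (f ∘ x) Vec.++ tabulate (f ∘ y)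
tabulate-++ f {zero}  x y = refl
tabulate-++ f {suc m} x y = cong (f (x zero) Vec.∷_)
  (trans (Vecₚ.tabulate-cong (cong f ∘ shift)) (tabulate-++ f (x ∘ suc) y))
  where
  shift : ∀ j → (x Vector.++ y) (suc j) ≡ ((x ∘ suc) Vector.++ y) j
  shift j with splitAt m j
  ... | inj₁ _ = refl
  ... | inj₂ _ = refl

true-does : ∀ {p} {P : Set p} (P? : Dec P) → does P? ≡ true → P
true-does (yes p) _ = p

module _ {L : Language} (M : Structure L) where

  private variable
    n k : ℕ
    ρ σ : Vector (Structure.Carrier M) n

  eval-cong  : (∀ j → ρ j ≡ σ j) → (t : Term L n) → eval M ρ t ≡ eval M σ t
  evals-cong : (∀ j → ρ j ≡ σ j) → (ts : Vec (Term L n) k) → evals M ρ ts ≡ evals M σ ts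
  eval-cong ρ≗σ (var x)    = ρ≗σ x
  eval-cong ρ≗σ (fun f ts) = cong (Structure.fun M f) (evals-cong ρ≗σ ts)
  evals-cong ρ≗σ Vec.[]       = refl
  evals-cong ρ≗σ (t Vec.∷ ts) = cong₂ Vec._∷_ (eval-cong ρ≗σ t) (evals-cong ρ≗σ ts)

  Sat-cong : (∀ j → ρ j ≡ σ j) → (φ : Formula L n) → Sat M φ ρ → Sat M φ σ
  Sat-cong ρ≗σ (eq s t)   p = trans (sym (eval-cong ρ≗σ s)) (trans p (eval-cong ρ≗σ t))
  Sat-cong ρ≗σ (rel r ts) p = subst (Structure.rel M r) (evals-cong ρ≗σ ts) p
  Sat-cong ρ≗σ (neg φ)    p = p ∘ Sat-cong (sym ∘ ρ≗σ) φ
  Sat-cong ρ≗σ (and φ ψ)  (p , q) = Sat-cong ρ≗σ φ p , Sat-cong ρ≗σ ψ q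
  Sat-cong ρ≗σ (ex φ)     (a , p) =
    a , Sat-cong (λ { zero → refl ; (suc j) → ρ≗σ j }) φ p

module FV (em : ExcludedMiddle (lsuc 0ℓ)) where

  em₀ : ExcludedMiddle 0ℓ
  em₀ = map′ lower lift em

  open Classical em₀ public

  module _ {b z} (emᶻ : ExcludedMiddle z) {I : Set} {B : I → Set b} {Z : I → Set z} {k}
           (c : ∀ i → Z i → B i → Vec Bool k) where

    -- The colouring for an existential quantifier: the characteristic vector of the set of colours
    -- that some choice of witness at `i` produces.
    attainable : ∀ i → B i → Vec Bool (length (bitVectors k))
    attainable i β = Vec.map (λ κ → does (emᶻ {∃[ ζ ] c i ζ β ≡ κ})) (Vec.fromList (bitVectors k))

    -- The colours of `ζ` are added to the attainable sets and copied to the other side by `extend`.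
    -- Each copied colour is attainable at its index: the pair of attainable set and colour also
    -- occurs at some `j` on the first side, where `ζ j` attains it.
    lift-witness : ∀ {N} → 1 ≤ N → {β β′ : ∀ i → B i} →
      (λ i → attainable i (β i)) ∼[ room k N ] (λ i → attainable i (β′ i)) →
      (ζ : ∀ i → Z i) →
      Σ[ ζ′ ∈ (∀ i → Z i) ] (λ i → c i (ζ i) (β i)) ∼[ N ] (λ i → c i (ζ′ i) (β′ i))
    lift-witness 1≤N {β} {β′} β∼β′ ζ
      with v′ , ∼₁ ← extend k β∼β′ (λ i → c i (ζ i) (β i)) =
        (λ i → proj₁ (choose i)) , ∼-map proj₂ (λ _ → refl) (λ i → sym (proj₂ (choose i))) ∼₁
      where
      -- Excluded middle for a Σ-type yields the witness itself, hence choice.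
      choose : ∀ i → ∃[ ζ ] c i ζ (β′ i) ≡ v′ i
      choose i with j , e ← ≲-point 1≤N (proj₂ ∼₁) i = true-does emᶻ
        (trans (map-fromList-injective (bitVectors k) (cong proj₁ e) (∈-bitVectors (v′ i)))
               (dec-true emᶻ (ζ j , sym (cong proj₂ e))))

  module _ {L : Language} (I : Set) (M : I → Structure L) where
    open Product I M

    private
      ∣_∣ : I → Set
      ∣ i ∣ = Structure.Carrier (M i)

    column : ∀ {m} → Vector ∏M m → ∀ i → Vec ∣ i ∣ m
    column a i = tabulate (λ j → a j i)

    slice : ∀ {s} → Vector (Pred I 0ℓ) s → I → Vec Set s
    slice X i = tabulate (λ v → X v i)

    -- Columns and slices are `Vec`s, not functions, so that a colouring respects
    -- pointwise equality.
    record Determined {m s} (P : Vector ∏M m → Vector (Pred I 0ℓ) s → Set₁) : Set₁ where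
      field
        bits threshold : ℕ
        colour    : ∀ i → Vec Set s → Vec ∣ i ∣ m → Vec Bool bits
        invariant : ∀ {a a′ X X′} →
          (λ i → colour i (slice X i) (column a i)) ∼[ threshold ]
          (λ i → colour i (slice X′ i) (column a′ i)) →
          P a X → P a′ X′

    open Determined

    -- One bit and threshold 1 suffice: the statement holds iff the colour false does not occur.
    determined-∀ : ∀ {m s} {P : Vector ∏M m → Vector (Pred I 0ℓ) s → Set₁}
      (Q : ∀ i → Vec Set s → Vec ∣ i ∣ m → Set) →
      (∀ a X → P a X ⇔ (∀ i → Q i (slice X i) (column a i))) → Determined P
    determined-∀ Q P⇔Q = record
      { bits      = 1
      ; threshold = 1
      ; colour    = λ i ξ α → does (em₀ {Q i ξ α}) Vec.∷ Vec.[]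
      ; invariant = λ {a} {a′} {X} {X′} (_ , ≲) p → from (P⇔Q a′ X′) λ i →
          let j , e = ≲-point ≤-refl ≲ i in
          true-does em₀ (trans (Vecₚ.∷-injectiveˡ e) (dec-true em₀ (to (P⇔Q a X) p j)))
      }

    localSet : ∀ {m s} i → Vec Set s → Vec ∣ i ∣ m → SetTerm L m s → Set
    localSet i ξ α (var v)    = lookup ξ v
    localSet i ξ α empty      = ∅ i
    localSet i ξ α full       = U i
    localSet i ξ α (meet t u) = localSet i ξ α t × localSet i ξ α u
    localSet i ξ α (join t u) = localSet i ξ α t ⊎ localSet i ξ α u
    localSet i ξ α (compl t)  = ¬ localSet i ξ α t
    localSet i ξ α ([ φ ] v)  = Sat (M i) φ (lookup α ∘ v)

    localSet-evalSet : ∀ {m s} (a : Vector ∏M m) (X : Vector (Pred I 0ℓ) s) t i →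
                       evalSet a X t i ⇔ localSet i (slice X i) (column a i) t
    localSet-evalSet a X (var v) i =
      mk⇔ (subst id (sym (Vecₚ.lookup∘tabulate _ v))) (subst id (Vecₚ.lookup∘tabulate _ v))
    localSet-evalSet a X empty i = ⇔-refl
    localSet-evalSet a X full  i = ⇔-refl
    localSet-evalSet a X (meet t u) i = localSet-evalSet a X t i ×-⇔ localSet-evalSet a X u i
    localSet-evalSet a X (join t u) i = localSet-evalSet a X t i ⊎-⇔ localSet-evalSet a X u i
    localSet-evalSet a X (compl t) i =
      let e = localSet-evalSet a X t i in mk⇔ (_∘ from e) (_∘ to e)
    localSet-evalSet a X ([ φ ] v) i =
      mk⇔ (Sat-cong (M i) (λ j → sym (Vecₚ.lookup∘tabulate _ (v j))) φ)
          (Sat-cong (M i) (λ j → Vecₚ.lookup∘tabulate _ (v j)) φ)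

    -- Induction on the formula. Atomic formulas are universal over the indices, negation uses the
    -- symmetry of `∼`, conjunction concatenates colours, and quantifiers pass to attainable sets of
    -- colours.
    determined : ∀ {m s} (φ : FVFormula L m s) → Determined (SatFV φ)
    determined (eqProd v w) = determined-∀ (λ i _ α → lookup α v ≡ lookup α w) λ a X →
      mk⇔ (λ (lift p) i →
             trans (Vecₚ.lookup∘tabulate _ v) (trans (p i) (sym (Vecₚ.lookup∘tabulate _ w))))
          (λ p → lift λ i →
             trans (sym (Vecₚ.lookup∘tabulate _ v)) (trans (p i) (Vecₚ.lookup∘tabulate _ w)))
    determined (eqSet t u) = determined-∀ (λ i ξ α → localSet i ξ α t ⇔ localSet i ξ α u) λ a X →
      let t⇔ = localSet-evalSet a X t
          u⇔ = localSet-evalSet a X u in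
      mk⇔ (λ (lift (t⊆u , u⊆t)) i → mk⇔ (λ p → to (u⇔ i) (t⊆u (from (t⇔ i) p)))
                                          (λ p → to (t⇔ i) (u⊆t (from (u⇔ i) p))))
          (λ e → lift ((λ {i} → from (u⇔ i) ∘ to (e i) ∘ to (t⇔ i)) ,
                        λ {i} → from (t⇔ i) ∘ from (e i) ∘ to (u⇔ i)))
    determined (neg φ) with d ← determined φ = record
      { Determined d
      ; invariant = λ (p , q) ¬sat → ¬sat ∘ invariant d (q , p)
      }
    determined (and φ ψ) with d ← determined φ | e ← determined ψ = record
      { bits      = bits d + bits e
      ; threshold = threshold d ⊔ threshold e
      ; colour    = λ i ξ α → colour d i ξ α Vec.++ colour e i ξ α
      ; invariant = λ h (p , q) →
          invariant d (∼-map (Vec.take (bits d)) (λ i → take-++ _ _) (λ i → take-++ _ _)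
            (∼-mono (m≤m⊔n _ _) h)) p ,
          invariant e (∼-map (Vec.drop (bits d))
            (λ i → drop-++ (colour d i _ _) _) (λ i → drop-++ (colour d i _ _) _)
            (∼-mono (m≤n⊔m _ _) h)) q
      }
      where
      take-++ : ∀ {m n} (xs : Vec Bool m) (ys : Vec Bool n) → Vec.take m (xs Vec.++ ys) ≡ xs
      take-++ Vec.[]       ys = refl
      take-++ (x Vec.∷ xs) ys = cong (x Vec.∷_) (take-++ xs ys)
      drop-++ : ∀ {m n} (xs : Vec Bool m) (ys : Vec Bool n) → Vec.drop m (xs Vec.++ ys) ≡ ys
      drop-++ Vec.[]       ys = refl
      drop-++ (x Vec.∷ xs) ys = drop-++ xs ys
    determined (exProd φ) with d ← determined φ = record
      { bits      = _
      -- The maximum with 1 meets the requirement `1 ≤ N` of `lift-witness`.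
      ; threshold = room (bits d) (threshold d ⊔ 1)
      ; colour    = λ i ξ α → attainable em₀ c i (ξ , α)
      ; invariant = λ h (b , sat) →
          let b′ , h′ = lift-witness em₀ c (m≤n⊔m _ 1) h b in
          b′ , invariant d (∼-mono (m≤m⊔n _ 1) h′) sat
      }
      where
      c : ∀ i → ∣ i ∣ → Vec Set _ × Vec ∣ i ∣ _ → Vec Bool (bits d)
      c i b (ξ , α) = colour d i ξ (b Vec.∷ α)
    determined (exSet φ) with d ← determined φ = record
      { bits      = _
      ; threshold = room (bits d) (threshold d ⊔ 1)
      ; colour    = λ i ξ α → attainable em c i (ξ , α)
      ; invariant = λ h (Y , sat) →
          let Y′ , h′ = lift-witness em c (m≤n⊔m _ 1) h Y in
          Y′ , invariant d (∼-mono (m≤m⊔n _ 1) h′) sat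
      }
      where
      -- A subset of `I` picks a proposition at each index, so it is a point of a product with all
      -- factors `Set`; attainability over `Set` is decided by excluded middle one level up.
      c : ∀ i → Set → Vec Set _ × Vec ∣ i ∣ _ → Vec Bool (bits d)
      c i Y (ξ , α) = colour d i (Y Vec.∷ ξ) α

-- Countable products of countable discrete spaces are Polish

-- The injection sending (x, y) to 2^x (2y + 1), which avoids 0 and so leaves a code for the empty
-- list.
pair : ℕ → ℕ → ℕ
pair zero    y = suc (2 * y)
pair (suc x) y = 2 * pair x y

pair-injective : ∀ x x′ {y y′} → pair x y ≡ pair x′ y′ → x ≡ x′ × y ≡ y′
pair-injective zero    zero     e = refl , *-cancelˡ-≡ _ _ 2 (suc-injective e)
pair-injective zero    (suc x′) {y} {y′} e = contradiction (sym e) (even≢odd (pair x′ y′) y)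
pair-injective (suc x) zero     {y} {y′} e = contradiction e (even≢odd (pair x y) y′)
pair-injective (suc x) (suc x′) e =
  let x≡x′ , y≡y′ = pair-injective x x′ (*-cancelˡ-≡ _ _ 2 e) in cong suc x≡x′ , y≡y′

pair≢0 : ∀ x {y} → pair x y ≢ 0
pair≢0 (suc x) e = pair≢0 x (m+n≡0⇒m≡0 _ e)

module _ {A : Set} (A↣ℕ : Countable A) where
  open Injection A↣ℕ using () renaming (to to code; injective to code-injective)

  Σ-countable : {B : A → Set} → (∀ a → Countable (B a)) → Countable (Σ A B)
  Σ-countable {B} B↣ℕ = mk↣ {to = λ (a , b) → pair (code a) (Injection.to (B↣ℕ a) b)} inj
    where
    inj : ∀ {p q : Σ A B} → pair (code (proj₁ p)) (Injection.to (B↣ℕ (proj₁ p)) (proj₂ p)) ≡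
                            pair (code (proj₁ q)) (Injection.to (B↣ℕ (proj₁ q)) (proj₂ q)) → p ≡ q
    inj {a , b} {a′ , b′} e
      with a≡a′ , b≡b′ ← pair-injective (code a) (code a′) e
      with refl ← code-injective a≡a′ = cong (a ,_) (Injection.injective (B↣ℕ a) b≡b′)

  List-countable : Countable (List A)
  List-countable = mk↣ {to = encode} (λ {xs} {ys} → encode-injective xs ys)
    where
    encode : List A → ℕ
    encode []       = 0
    encode (x ∷ xs) = pair (code x) (encode xs)
    encode-injective : ∀ xs ys → encode xs ≡ encode ys → xs ≡ ys
    encode-injective [] [] _ = refl
    encode-injective [] (y ∷ ys) e = contradiction (sym e) (pair≢0 (code y))
    encode-injective (x ∷ xs) [] e = contradiction e (pair≢0 (code x))
    encode-injective (x ∷ xs) (y ∷ ys) e =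
      let x≡y , xs≡ys = pair-injective (code x) (code y) e in
      cong₂ _∷_ (code-injective x≡y) (encode-injective xs ys xs≡ys)

Fin-countable : ∀ n → Countable (Fin n)
Fin-countable n = mk↣ Finₚ.toℕ-injective

Bool-countable : Countable Bool
Bool-countable = mk↣ {to = λ { false → 0 ; true → 1 }}
  λ { {false} {false} _ → refl ; {true} {true} _ → refl }

⊥-countable : Countable ⊥
⊥-countable = mk↣ {to = λ ()} λ { {()} }

-- This is 1/(n+1), as `mkℚ` stores the denominator minus one.
unitFraction : ℕ → ℚ
unitFraction n = mkℚ (+ 1) n (1-coprimeTo (suc n))

unitFraction-positive : ∀ n → 0ℚ ℚ.< unitFraction n
unitFraction-positive n = *<* (+<+ (s≤s z≤n))

unitFraction-antimono : ∀ {m n} → unitFraction m ℚ.< unitFraction n → n < m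
unitFraction-antimono {m} {n} (*<* (+<+ p)) =
  s<s⁻¹ (subst₂ _<_ (*-identityˡ (suc n)) (*-identityˡ (suc m)) p)

unitFraction-archimedean : ∀ {ε} → 0ℚ ℚ.< ε → ∃[ n ] unitFraction n ℚ.< ε
-- For ε = (p+1)/(d+1), the witness 1/(d+2) lies strictly below 1/(d+1) ≤ ε.
unitFraction-archimedean {mkℚ (+ suc p) d _} _ = suc d , *<* (+<+
  (subst (_< suc p * suc (suc d)) (sym (*-identityˡ (suc d)))
    (<-≤-trans (n<1+n (suc d)) (m≤m+n (suc (suc d)) (p * suc (suc d))))))
unitFraction-archimedean {mkℚ (+ 0) d _} (*<* (+<+ ()))
unitFraction-archimedean {mkℚ (-[1+ _ ]) d _} (*<* ())

-- The union runs over codes `s` because its index type must be small, which the type of all open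
-- sets is not.
neighbourhoods⇒Open : (X : TopologicalSpace) → let open TopologicalSpace X in
  {S : Set} (N : S → Pred Carrier 0ℓ) → (∀ s → Open (N s)) →
  ∀ {A} → (∀ x → A x → ∃[ s ] N s x × N s ⊆ A) → Open A
neighbourhoods⇒Open X {S} N N-open {A} nbhd = Open-≐
  ((λ ((s , N⊆A) , x∈N) → N⊆A x∈N) ,
   (λ {x} x∈A → let s , x∈N , N⊆A = nbhd x x∈A in (s , λ {y} → N⊆A {y}) , x∈N))
  (Open-⋃ (Σ[ s ∈ S ] N s ⊆ A) (N ∘ proj₁) (N-open ∘ proj₁))
  where open TopologicalSpace X

module _ {I : Set} (A : I → Set) where

  Π-discrete : TopologicalSpace
  Π-discrete = Π-space I (discrete ∘ A)

  box : List (Σ I A) → Pred (∀ i → A i) 0ℓ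
  box s x = All (λ (i , a) → x i ≡ a) s

  box-open : ∀ s → TopologicalSpace.Open Π-discrete (box s)
  box-open [] = resp ((λ _ → []) , λ _ → _) whole
  box-open ((i , a) ∷ s) = resp ((λ (p , q) → p ∷ q) , λ { (p ∷ q) → p , q })
    (inter (subbasic (cylinder i {_≡ a} _)) (box-open s))

  open⇒box-neighbourhood : ∀ {B} → TopologicalSpace.Open Π-discrete B →
                           ∀ x → B x → ∃[ s ] box s x × box s ⊆ B
  open⇒box-neighbourhood (subbasic (cylinder i {C} _)) x x∈B =
    (i , x i) ∷ [] , refl ∷ [] , λ { (e ∷ []) → subst C (sym e) x∈B }
  open⇒box-neighbourhood (resp (B⊆C , C⊆B) o) x x∈C =
    let s , x∈s , s⊆B = open⇒box-neighbourhood o x (C⊆B x∈C) in s , x∈s , λ y∈s → B⊆C (s⊆B y∈s)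
  open⇒box-neighbourhood whole x _ = [] , [] , λ _ → _
  open⇒box-neighbourhood (inter o o′) x (x∈B , x∈B′) =
    let s , x∈s , s⊆B = open⇒box-neighbourhood o x x∈B
        s′ , x∈s′ , s′⊆B′ = open⇒box-neighbourhood o′ x x∈B′
    in s ++ s′ , Allₚ.++⁺ x∈s x∈s′ , λ y∈ → s⊆B (Allₚ.++⁻ˡ s y∈) , s′⊆B′ (Allₚ.++⁻ʳ s y∈)
  open⇒box-neighbourhood (union J B o) x (j , x∈B) =
    let s , x∈s , s⊆B = open⇒box-neighbourhood (o j) x x∈B in s , x∈s , λ y∈s → j , s⊆B y∈s

module Polish (em : ExcludedMiddle 0ℓ) {I : Set} (I↣ℕ : Countable I)
              {A : I → Set} (A↣ℕ : ∀ i → Countable (A i)) where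

  open Injection I↣ℕ using () renaming (to to code; injective to code-injective)

  private
    X : TopologicalSpace
    X = Π-discrete A
    open TopologicalSpace X

  separable : Separable X
  separable with em {Carrier}
  -- An empty product has the empty dense family; otherwise finite modifications of one point are
  -- dense.
  ... | no none = ⊥ , ⊥-countable , (λ ()) , λ _ _ (x , _) → contradiction x none
  ... | yes x₀ = List (Σ I A) , List-countable (Σ-countable I↣ℕ A↣ℕ) , override ,
        λ B o (x , x∈B) → let s , x∈s , s⊆B = open⇒box-neighbourhood A o x x∈B in
          s , s⊆B (override-box x∈s)
    where
    override : List (Σ I A) → Carrier
    override s i with em {∃[ a ] (i , a) ∈ s}
    ... | yes (a , _) = a
    ... | no _        = x₀ i
    override-box : ∀ {s x} → box A s x → box A s (override s)
    override-box {s} {x} x∈s = All.tabulate agree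
      where
      agree : ∀ {p} → p ∈ s → override s (proj₁ p) ≡ proj₂ p
      agree {i , a} ia∈s with em {∃[ a ] (i , a) ∈ s}
      -- The value found may come from another entry for `i`, but `x` satisfies both entries, so
      -- they coincide.
      ... | yes (a′ , ia′∈s) = trans (sym (All.lookup x∈s ia′∈s)) (All.lookup x∈s ia∈s)
      ... | no none = contradiction (a , ia∈s) none

  Agree : ℕ → Carrier → Carrier → Set
  Agree n x y = ∀ i → code i < n → x i ≡ y i

  metric : Metric points
  metric = record
    { dist = dist
    ; nonneg = nonneg
    ; zero-iff = λ x y → mk⇔ (separated x y) (λ x≈y → null x≈y , nonneg x y)
    ; symm = λ x y → swap x y , swap y x
    ; triangle = triangle
    }
    where
    -- The infimum of 1/(n+1) over all n such that x and y agree on the codes below n.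
    dist : Carrier → Carrier → ℝ
    dist x y = record
      { cut       = λ q → ∃[ n ] unitFraction n ℚ.< q × Agree n x y
      -- Agreement below 0 is vacuous, so no distance exceeds 1 and any rational above 1 serves.
      ; inhabited = 1ℚ ℚ.+ 1ℚ , 0 , from-yes (unitFraction 0 ℚₚ.<? 1ℚ ℚ.+ 1ℚ) , λ _ ()
      ; proper    = 0ℚ , λ (n , n<0 , _) → ℚₚ.<-asym n<0 (unitFraction-positive n)
      ; upward    = λ p≤q (n , n<p , agree) → n , ℚₚ.<-≤-trans n<p p≤q , agree
      ; open-cut  = λ (n , n<q , agree) →
          let p , n<p , p<q = ℚₚ.<-dense n<q in p , p<q , n , n<p , agree
      }
    nonneg : ∀ x y → 0ℝ ≤ℝ dist x y
    nonneg x y (n , n<q , _) = ℚₚ.<-trans (unitFraction-positive n) n<q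
    separated : ∀ x y → dist x y ≃ℝ 0ℝ → x ≈ y
    separated x y (d≤0 , _) i with d≤0 (unitFraction-positive (code i))
    ... | n , n< , agree = agree i (unitFraction-antimono n<)
    null : ∀ {x y} → x ≈ y → dist x y ≤ℝ 0ℝ
    null x≈y 0<q = let n , n<q = unitFraction-archimedean 0<q in n , n<q , λ i _ → x≈y i
    swap : ∀ x y → dist x y ≤ℝ dist y x
    swap x y (n , n<q , agree) = n , n<q , λ i i< → sym (agree i i<)
    r<r+s : ∀ {r s} n → unitFraction n ℚ.< s → r ℚ.< r ℚ.+ s
    r<r+s {r} {s} n n<s = subst (ℚ._< r ℚ.+ s) (ℚₚ.+-identityʳ r)
      (ℚₚ.+-monoʳ-< r (ℚₚ.<-trans (unitFraction-positive n) n<s))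
    -- The ultrametric inequality holds: `x` and `z` agree below the smaller of the two bounds, and
    -- the other summand is positive.
    triangle : ∀ x y z → dist x z ≤ℝ dist x y +ℝ dist y z
    triangle x y z (r , s , (m , m< , xy) , (n , n< , yz) , r+s≤q) with ≤-total m n
    ... | inj₁ m≤n = m , ℚₚ.<-≤-trans (ℚₚ.<-trans m< (r<r+s n n<)) r+s≤q ,
          λ i i< → trans (xy i i<) (yz i (<-≤-trans i< m≤n))
    ... | inj₂ n≤m =
          n , ℚₚ.<-≤-trans (ℚₚ.<-trans n< (subst (s ℚ.<_) (ℚₚ.+-comm s r) (r<r+s m m<))) r+s≤q ,
          λ i i< → trans (xy i (<-≤-trans i< n≤m)) (yz i i<)

  open Metric metric

  -- Strictness forces agreement below some `m > n`, hence at code `n` as well.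
  dist-agree : ∀ {x y n} → dist x y <ℚ unitFraction n → Agree (suc n) x y
  dist-agree (m , m< , agree) i i<1+n = agree i (≤-trans i<1+n (unitFraction-antimono m<))

  -- Coordinate `i` of a Cauchy sequence is constant from `index i` on; the limit reads it there.
  complete : Complete
  complete s cauchy = limit , λ ε 0<ε →
    let n , n<ε = unitFraction-archimedean 0<ε
        N , close = cauchy _ (unitFraction-positive n)
    in N , λ m N≤m → n , n<ε , λ i i<n → trans
         -- Terms `m` and `index i` are compared through the later term `N ⊔ index i`.
         (dist-agree (close m (N ⊔ index i) N≤m (m≤m⊔n _ _)) i (m<n⇒m<1+n i<n))
         (dist-agree (proj₂ (modulus i) _ _ (m≤n⊔m N _) ≤-refl) i ≤-refl)
    where
    modulus : ∀ i → ∃[ N ] ∀ m n → N ≤ m → N ≤ n → dist (s m) (s n) <ℚ unitFraction (code i)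
    modulus i = cauchy _ (unitFraction-positive (code i))
    index : I → ℕ
    index i = proj₁ (modulus i)
    limit : Carrier
    limit i = s (index i) i

  box-agree : ∀ s → ∃[ n ] ∀ {x y} → box A s x → Agree n x y → box A s y
  box-agree [] = 0 , λ _ _ → []
  box-agree ((i , a) ∷ s) with n , agree ← box-agree s = suc (code i) ⊔ n , λ
    { (e ∷ x∈s) x~y → trans (sym (x~y i (m≤m⊔n _ n))) e ∷
        agree x∈s (λ j j<n → x~y j (<-≤-trans j<n (m≤n⊔m _ n))) }

  -- The injectivity of `code` leaves at most one coordinate to fix for each number below `n`, so
  -- finitely many entries suffice. With `box-agree`, boxes and balls generate the same topology.
  agree-box : ∀ n x → ∃[ s ] box A s x × (∀ {y} → box A s y → Agree n x y)
  agree-box zero x = [] , [] , λ _ _ ()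
  agree-box (suc n) x with s , x∈s , agree ← agree-box n x | em {∃[ i ] code i ≡ n}
  ... | no none = s , x∈s , λ y∈s i i<1+n → agree y∈s i (≤∧≢⇒< (≤-pred i<1+n) λ e → none (i , e))
  ... | yes (j , refl) = (j , x j) ∷ s , refl ∷ x∈s , λ { {y} (e ∷ y∈s) i i<1+n →
        case m≤n⇒m<n∨m≡n (≤-pred i<1+n) of λ
        { (inj₁ i<n) → agree y∈s i i<n
        ; (inj₂ i≡n) → case code-injective i≡n of λ { refl → sym e } } }

  isPolish : IsPolish X
  isPolish = separable , metric , complete , λ B → mk⇔
    (λ o x x∈B →
      let s , x∈s , s⊆B = open⇒box-neighbourhood A o x x∈B
          n , agree = box-agree s
      in unitFraction n , unitFraction-positive n ,
         λ y d<ε → s⊆B (agree x∈s λ i i<n → dist-agree d<ε i (m<n⇒m<1+n i<n)))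
    (λ o → neighbourhoods⇒Open X (box A) (box-open A) λ x x∈B →
      let ε , 0<ε , ball⊆B = o x x∈B
          n , n<ε = unitFraction-archimedean 0<ε
          s , x∈s , agree = agree-box n x
      in s , x∈s , λ {y} y∈s → ball⊆B y (n , n<ε , agree y∈s))

-- Borel sets and smoothness

module Smoothness (em : ExcludedMiddle (lsuc 0ℓ)) where
  open FV em

  module _ {X : TopologicalSpace} where
    open TopologicalSpace X

    borel-U : IsBorel X U
    borel-U = open-set Open-U

    borel-∅ : IsBorel X ∅
    borel-∅ = resp ((λ ¬u → ¬u _) , λ ()) (complement borel-U)

    borel-⋃ : ∀ {J : Set} → Countable J → {A : J → Pred Carrier 0ℓ} →
              (∀ j → IsBorel X (A j)) → IsBorel X (⋃ J A)
    borel-⋃ {J} J↣ℕ {A} A-borel = resp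
      ((λ (n , j , _ , x∈A) → j , x∈A) , (λ (j , x∈A) → code j , j , refl , x∈A))
      (union (λ n x → ∃[ j ] code j ≡ n × A j x) layer)
      where
      open Injection J↣ℕ using () renaming (to to code; injective to code-injective)
      layer : ∀ n → IsBorel X (λ x → ∃[ j ] code j ≡ n × A j x)
      layer n with em₀ {∃[ j ] code j ≡ n}
      ... | no none = resp ((λ ()) , λ (j , e , _) → none (j , e)) borel-∅
      ... | yes (j , refl) = resp
              ((λ x∈A → j , refl , x∈A) ,
               λ (_ , e , x∈A) → subst (λ j → A j _) (code-injective e) x∈A)
              (A-borel j)

    borel-∪ : ∀ {A B} → IsBorel X A → IsBorel X B → IsBorel X (A ∪ B)
    borel-∪ {A} {B} a b = resp
      ((λ { (true , x∈A) → inj₁ x∈A ; (false , x∈B) → inj₂ x∈B }) ,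
       (λ { (inj₁ x∈A) → true , x∈A ; (inj₂ x∈B) → false , x∈B }))
      (borel-⋃ Bool-countable {λ { true → A ; false → B }} λ { true → a ; false → b })

    borel-∩ : ∀ {A B} → IsBorel X A → IsBorel X B → IsBorel X (A ∩ B)
    borel-∩ a b = resp
      ((λ ¬∪ → decidable-stable em₀ (¬∪ ∘ inj₁) , decidable-stable em₀ (¬∪ ∘ inj₂)) ,
       (λ { (x∈A , _) (inj₁ x∉A) → x∉A x∈A ; (_ , x∈B) (inj₂ x∉B) → x∉B x∈B }))
      (complement (borel-∪ (complement a) (complement b)))

    -- `Q` is a Boolean combination of the sets `V t`, by induction on `ts`. Splitting along `V t`
    -- leaves pieces of `Q` that need not be invariant under the remaining conditions, so `part`
    -- saturates them before the induction hypothesis is applied.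
    borel-determined : ∀ {T : Set} {V : T → Pred Carrier 0ℓ} → (∀ t → IsBorel X (V t)) →
      (ts : List T) (Q : Pred Carrier 0ℓ) →
      (∀ {x y} → All (λ t → V t x ⇔ V t y) ts → Q x → Q y) → IsBorel X Q
    borel-determined V-borel [] Q inv with em₀ {Satisfiable Q}
    ... | yes (x , x∈Q) = resp ((λ _ → inv [] x∈Q) , λ _ → _) borel-U
    ... | no none = resp ((λ ()) , λ x∈Q → none (_ , x∈Q)) borel-∅
    borel-determined {V = V} V-borel (t ∷ ts) Q inv = resp (⊆Q , Q⊆)
      (borel-∪ (borel-∩ (V-borel t) (sub (V t))) (borel-∩ (complement (V-borel t)) (sub (∁ (V t)))))
      where
      part : Pred Carrier 0ℓ → Pred Carrier 0ℓ
      part C x = ∃[ y ] C y × Q y × All (λ t → V t y ⇔ V t x) ts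
      sub : ∀ C → IsBorel X (part C)
      sub C = borel-determined V-borel ts (part C) λ x≈x′ (y , y∈C , y∈Q , y≈x) →
        y , y∈C , y∈Q , All.zipWith (λ (p , q) → mk⇔ (to q ∘ to p) (from p ∘ from q)) (y≈x , x≈x′)
      ⊆Q : (V t ∩ part (V t)) ∪ (∁ (V t) ∩ part (∁ (V t))) ⊆ Q
      ⊆Q (inj₁ (x∈V , y , y∈V , y∈Q , y≈x)) = inv (mk⇔ (λ _ → x∈V) (λ _ → y∈V) ∷ y≈x) y∈Q
      ⊆Q (inj₂ (x∉V , y , y∉V , y∈Q , y≈x)) =
        inv (mk⇔ (λ y∈V → contradiction y∈V y∉V) (λ x∈V → contradiction x∈V x∉V) ∷ y≈x) y∈Q
      Q⊆ : Q ⊆ (V t ∩ part (V t)) ∪ (∁ (V t) ∩ part (∁ (V t)))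
      Q⊆ {x} x∈Q with em₀ {V t x}
      ... | yes x∈V = inj₁ (x∈V , x , x∈V , x∈Q , All.universal (λ _ → mk⇔ id id) ts)
      ... | no  x∉V = inj₂ (x∉V , x , x∉V , x∈Q , All.universal (λ _ → mk⇔ id id) ts)

    -- The preimage of an open set is the countable union of the preimages of the boxes inside it,
    -- and a box fixes finitely many bits.
    borel-map-Cantor : ∀ {S : Set} → Countable S → (θ : Carrier → S → Bool) →
      (∀ s → IsBorel X (λ x → θ x s ≡ true)) → IsBorelMap X (Π-discrete (λ (_ : S) → Bool)) θ
    borel-map-Cantor {S} S↣ℕ θ θ-borel A (open-set o) = resp
      ((λ (b , x∈b , b⊆A) → b⊆A x∈b) ,
       (λ {x} θx∈A → let b , x∈b , b⊆A = open⇒box-neighbourhood _ o (θ x) θx∈A in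
          b , x∈b , λ {y} → b⊆A {y}))
      (borel-⋃ (List-countable (Σ-countable S↣ℕ (λ _ → Bool-countable))) inside)
      where
      bits-borel : ∀ b → IsBorel X (λ x → box (λ (_ : S) → Bool) b (θ x))
      bits-borel [] = resp ((λ _ → []) , λ _ → _) borel-U
      bits-borel ((s , true) ∷ b) = resp ((λ (p , q) → p ∷ q) , λ { (p ∷ q) → p , q })
        (borel-∩ (θ-borel s) (bits-borel b))
      bits-borel ((s , false) ∷ b) = resp
        ((λ (p , q) → ¬-not p ∷ q) , λ { (p ∷ q) → not-¬ p , q })
        (borel-∩ (complement (θ-borel s)) (bits-borel b))
      inside : ∀ b → IsBorel X (λ x → box _ b (θ x) × box _ b ⊆ A)
      inside b with em₀ {box _ b ⊆ A}
      ... | yes b⊆A = resp ((λ p → p , λ {y} → b⊆A {y}) , proj₁) (bits-borel b)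
      ... | no b⊈A = resp ((λ ()) , λ (_ , b⊆A) → b⊈A (λ {y} → b⊆A {y})) borel-∅
    borel-map-Cantor S↣ℕ θ θ-borel A (resp (B⊆A , A⊆B) b) =
      resp (B⊆A , A⊆B) (borel-map-Cantor S↣ℕ θ θ-borel _ b)
    borel-map-Cantor S↣ℕ θ θ-borel A (complement b) =
      complement (borel-map-Cantor S↣ℕ θ θ-borel _ b)
    borel-map-Cantor S↣ℕ θ θ-borel A (union B b) =
      union (λ n → B n ∘ θ) (λ n → borel-map-Cantor S↣ℕ θ θ-borel _ (b n))

  -- Saturations of cells and the classifying map

  module _ {L : Language} {I : Set} (M : I → Structure L) (n : ℕ) where
    open Product I M

    private
      ∣_∣ : I → Set
      ∣ i ∣ = Structure.Carrier (M i)

      col : Vector ∏M n → ∀ i → Vec ∣ i ∣ n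
      col = column I M

    Constraint : Set
    Constraint = Fin n × Σ I ∣_∣

    cell : List Constraint → Pred (Vector ∏M n) 0ℓ
    cell s x = All (λ (j , i , a) → x j i ≡ a) s

    cell-open : ∀ s → TopologicalSpace.Open (power-space n) (cell s)
    cell-open [] = resp ((λ _ → []) , λ _ → _) whole
    cell-open ((j , i , a) ∷ s) = resp ((λ (p , q) → p ∷ q) , λ { (p ∷ q) → p , q })
      (inter (subbasic (cylinder j (subbasic (cylinder i {_≡ a} _)))) (cell-open s))

    cell-around : (x : Vector ∏M n) (is : List I) → ∃[ s ] cell s x ×
                  (∀ {y} → cell s y → ∀ {i} → i ∈ is → col y i ≡ col x i)
    cell-around x is =
      map entry (cartesianProduct (allFin n) is) ,
      Allₚ.map⁺ (All.universal (λ _ → refl) _) ,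
      λ y∈s i∈is → Vecₚ.tabulate-cong λ j →
        All.lookup (Allₚ.map⁻ y∈s) (∈-cartesianProduct⁺ (∈-allFin j) i∈is)
      where
      entry : Fin n × I → Constraint
      entry (j , i) = j , i , x j i

    module _ {k} (d : ∀ i → Vec ∣ i ∣ n → Vec Bool k) where

      occurs : Vec Bool k × ℕ → Pred (Vector ∏M n) 0ℓ
      occurs (κ , r) x = AtLeast r (λ i → d i (col x i) ≡ κ)

      -- Fixing the columns at the finitely many listed indices preserves their colours.
      occurs-neighbourhood : ∀ t x → occurs t x → ∃[ s ] cell s x × cell s ⊆ occurs t
      occurs-neighbourhood t x (is , u , is⊆κ , r≤) =
        let s , x∈s , same = cell-around x is in
        s , x∈s , λ y∈s → is , u ,
          All.tabulate (λ i∈is → trans (cong (d _) (same y∈s i∈is)) (All.lookup is⊆κ i∈is)) , r≤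

      occurs-borel : ∀ t → IsBorel (power-space n) (occurs t)
      occurs-borel t = open-set
        (neighbourhoods⇒Open (power-space n) cell cell-open (occurs-neighbourhood t))

      counts : ℕ → List (Vec Bool k × ℕ)
      counts N = cartesianProduct (bitVectors k) (upTo (suc N))

      occurs-∼ : ∀ N {x y} → All (λ t → occurs t x ⇔ occurs t y) (counts N) →
                 (λ i → d i (col x i)) ∼[ N ] (λ i → d i (col y i))
      occurs-∼ N same = ∼-fibres λ κ r r≤N →
        let e = All.lookup same (∈-cartesianProduct⁺ (∈-bitVectors κ) (∈-upTo⁺ (s≤s r≤N))) in
        to e , from e

      -- The conditions are treated in turn. If one holds somewhere on `W` within the current cell,
      -- shrinking to a neighbourhood makes it true throughout; otherwise it is already false
      -- throughout.
      stabilise : (W : Pred (Vector ∏M n) (lsuc 0ℓ)) → ∀ ts s {v} → W v → cell s v →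
        ∃[ s′ ] Satisfiable (W ∩ cell s′) × cell s′ ⊆ cell s ×
          (∀ {y y′} → W y → cell s′ y → W y′ → cell s′ y′ →
             All (λ t → occurs t y ⇔ occurs t y′) ts)
      stabilise W [] s {v} v∈W v∈s = s , (v , v∈W , v∈s) , id , λ _ _ _ _ → []
      stabilise W (t ∷ ts) s {v} v∈W v∈s with em {∃[ v ] W v × cell s v × occurs t v}
      ... | yes (v₁ , v₁∈W , v₁∈s , v₁∈t) =
        let s₁ , v₁∈s₁ , s₁⊆t = occurs-neighbourhood t v₁ v₁∈t
            s′ , meets , s′⊆ , const = stabilise W ts (s ++ s₁) v₁∈W (Allₚ.++⁺ v₁∈s v₁∈s₁)
            s′⊆t : cell s′ ⊆ occurs t
            s′⊆t y∈ = s₁⊆t (Allₚ.++⁻ʳ s (s′⊆ y∈))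
        in s′ , meets , Allₚ.++⁻ˡ s ∘ s′⊆ , λ y∈W y∈ y′∈W y′∈ →
             mk⇔ (λ _ → s′⊆t y′∈) (λ _ → s′⊆t y∈) ∷ const y∈W y∈ y′∈W y′∈
      ... | no none =
        let s′ , meets , s′⊆ , const = stabilise W ts s v∈W v∈s
        in s′ , meets , s′⊆ , λ y∈W y∈ y′∈W y′∈ →
             mk⇔ (λ y∈t → contradiction (_ , y∈W , s′⊆ y∈ , y∈t) none)
                 (λ y′∈t → contradiction (_ , y′∈W , s′⊆ y′∈ , y′∈t) none)
             ∷ const y∈W y∈ y′∈W y′∈

    module _ (I↣ℕ : Countable I) (M↣ℕ : ∀ i → Countable ∣ i ∣)
             {ℓ} {E : Rel (Vector ∏M n) ℓ} (isEq : IsEquivalence E)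
             (φ : FVFormula L (n + n) 0) (D : Determined I M (SatFV φ))
             (E⇔φ : ∀ x y → E x y ⇔ SatFV φ (x Vector.++ y) Vector.[]) where

      private
        module E = IsEquivalence isEq
        module D = Determined D

        N : ℕ
        N = D.threshold

      R : Rel (Vector ∏M n) (lsuc 0ℓ)
      R x y = SatFV φ (x Vector.++ y) Vector.[]

      -- The quantified coordinate `η` comes first, as `attainable` and `lift-witness` expect.
      hue : ∀ i → Vec ∣ i ∣ n → Vec ∣ i ∣ n → Vec Bool D.bits
      hue i η ξ = D.colour i Vec.[] (ξ Vec.++ η)

      R-invariant : ∀ {x x′ y y′} →
        (λ i → hue i (col y i) (col x i)) ∼[ N ] (λ i → hue i (col y′ i) (col x′ i)) →
        R x y → R x′ y′
      R-invariant {x} {x′} {y} {y′} h =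
        D.invariant (∼-map id (λ i → split x y) (λ i → split x′ y′) h)
        where
        split : ∀ x y {i} → hue i (col y i) (col x i) ≡
                            D.colour i Vec.[] (column I M (x Vector.++ y) i)
        split x y {i} = cong (D.colour i Vec.[]) (sym (tabulate-++ (λ b → b i) x y))

      Saturation : List Constraint → Pred (Vector ∏M n) (lsuc 0ℓ)
      Saturation s x = ∃[ y ] cell s y × R x y

      module _ (s : List Constraint) where

        Obeys : ∀ i → Vec ∣ i ∣ n → Set
        Obeys i η = ∀ j a → (j , i , a) ∈ s → lookup η j ≡ a

        -- Membership in a cell is a condition on each column separately, so one extra bit keeps a
        -- transferred witness inside the cell.
        hue⁺ : ∀ i → Vec ∣ i ∣ n → Vec ∣ i ∣ n → Vec Bool (suc D.bits)
        hue⁺ i η ξ = does (em₀ {Obeys i η}) Vec.∷ hue i η ξ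

        shade : ∀ i → Vec ∣ i ∣ n → Vec Bool _
        shade = attainable em₀ hue⁺

        Nˢ : ℕ
        Nˢ = room (suc D.bits) (N ⊔ 1)

        Saturation-invariant : ∀ {x x′} →
          (λ i → shade i (col x i)) ∼[ Nˢ ] (λ i → shade i (col x′ i)) →
          Saturation s x → Saturation s x′
        Saturation-invariant {x} {x′} h (y , y∈s , Rxy) =
          y′ , All.tabulate (λ {(j , i , a)} ∈s → obeys i j a ∈s) ,
          R-invariant (∼-map Vec.tail (λ _ → refl)
            (λ i → cong (λ η → hue i η (col x′ i)) (sym (Vecₚ.tabulate∘lookup (ζ i))))
            (∼-mono (m≤m⊔n N 1) h′)) Rxy
          where
          witness : Σ[ ζ ∈ (∀ i → Vec ∣ i ∣ n) ]
                      (λ i → hue⁺ i (col y i) (col x i)) ∼[ N ⊔ 1 ]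
                      (λ i → hue⁺ i (ζ i) (col x′ i))
          witness = lift-witness em₀ hue⁺ (m≤n⊔m N 1) h (col y)
          ζ = proj₁ witness
          h′ = proj₂ witness
          y′ : Vector ∏M n
          y′ j i = lookup (ζ i) j
          obeys : ∀ i → Obeys i (ζ i)
          obeys i =
            -- The extra bit is true everywhere along `y`, hence everywhere along `ζ`.
            let _ , e = ≲-point (m≤n⊔m N 1) (proj₂ h′) i in
            true-does em₀ (trans (Vecₚ.∷-injectiveˡ e) (dec-true em₀ λ j a ∈s →
              trans (Vecₚ.lookup∘tabulate _ j) (All.lookup y∈s ∈s)))

      θ : Vector ∏M n → List Constraint → Bool
      θ x s = does (em {Saturation s x})

      θ-borel : ∀ s → IsBorel (power-space n) (λ x → θ x s ≡ true)
      θ-borel s = borel-determined (occurs-borel (shade s)) (counts (shade s) (Nˢ s)) _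
        λ same θx → dec-true em
          (Saturation-invariant s (occurs-∼ (shade s) _ same) (true-does em θx))

      θ-cong : ∀ {x x′} → E x x′ → ∀ s → θ x s ≡ θ x′ s
      θ-cong {x} {x′} Exx′ s with em {Saturation s x} | em {Saturation s x′}
      ... | yes _ | yes _ = refl
      ... | no _  | no _  = refl
      ... | yes (y , y∈s , Rxy) | no none = contradiction
        (y , y∈s , to (E⇔φ x′ y) (E.trans (E.sym Exx′) (from (E⇔φ x y) Rxy))) none
      ... | no none | yes (y , y∈s , Rx′y) = contradiction
        (y , y∈s , to (E⇔φ x y) (E.trans Exx′ (from (E⇔φ x′ y) Rx′y))) none

      -- The point `v` serves one class, and equality of the `θ` values supplies a point of the
      -- other class in the same cell.
      meet-both : ∀ {x x′} → (∀ s → θ x s ≡ θ x′ s) → ∀ {s v} → R x v ⊎ R x′ v → cell s v →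
                  ∃[ y ] cell s y × R x y × ∃[ y′ ] cell s y′ × R x′ y′
      meet-both same {s} {v} (inj₁ Rxv) v∈s =
        v , v∈s , Rxv , true-does em (trans (sym (same s)) (dec-true em (v , v∈s , Rxv)))
      meet-both same {s} {v} (inj₂ Rx′v) v∈s =
        let y , y∈s , Rxy = true-does em (trans (same s) (dec-true em (v , v∈s , Rx′v))) in
        y , y∈s , Rxy , v , v∈s , Rx′v

      θ-separates : ∀ x x′ → (∀ s → θ x s ≡ θ x′ s) → E x x′
      θ-separates x x′ same
        -- The shrinking starts from the whole space, coded by `[]`, at the point `x` of its own
        -- class.
        with s , (v , v∈W , v∈s) , _ , const ← stabilise (λ i η → hue i η (col x i))
               (λ v → R x v ⊎ R x′ v) (counts (λ i η → hue i η (col x i)) N)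
               [] (inj₁ (to (E⇔φ x x) E.refl)) []
        with y , y∈s , Rxy , y′ , y′∈s , Rx′y′ ← meet-both same v∈W v∈s =
          -- With `x` fixed in the colouring, the constant conditions on `W` carry `R x y` over to
          -- `R x y′`.
          E.trans (from (E⇔φ x y′) (R-invariant (occurs-∼ (λ i η → hue i η (col x i)) N
              (const (inj₁ Rxy) y∈s (inj₂ Rx′y′) y′∈s)) Rxy))
            (E.sym (from (E⇔φ x′ y′) Rx′y′))

      constraint-countable : Countable (List Constraint)
      constraint-countable =
        List-countable (Σ-countable (Fin-countable n) (λ _ → Σ-countable I↣ℕ M↣ℕ))

      -- Pointwise equal tuples have equal columns, so the colouring cannot tell them apart and
      -- reflexivity transfers.
      ≈⇒E : ∀ {x x′} → (∀ j i → x j i ≡ x′ j i) → E x x′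
      ≈⇒E {x} {x′} x≈x′ = from (E⇔φ x x′) (R-invariant
        (∼-reflexive λ i → cong (λ η → hue i η (col x i)) (Vecₚ.tabulate-cong λ j → x≈x′ j i))
        (to (E⇔φ x x) E.refl))

      smooth : Smooth (power-space n) E
      smooth = record
        { target = record
          { space    = Π-discrete (λ (_ : List Constraint) → Bool)
          ; isPolish = Polish.isPolish em₀ constraint-countable (λ _ → Bool-countable)
          }
        ; map        = record { to = θ ; cong = θ-cong ∘ ≈⇒E }
        ; borel      = borel-map-Cantor constraint-countable θ θ-borel
        ; classifies = λ x y → mk⇔ θ-cong (θ-separates x y)
        }

mainTheorem20 : {ℓ : Level} → ExcludedMiddle (lsuc 0ℓ) →
    (L : Language) (I : Set) (M : I → Structure L) →
    Countable I → (∀ i → Countable (Structure.Carrier (M i))) →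
    let open Product I M in
    IsPolish ∏M-space ×
    (∀ (n : ℕ) (E : Rel (Vector ∏M n) ℓ) →
    IsEquivalence E → Definable n E → Smooth (power-space n) E)
mainTheorem20 em L I M I↣ℕ M↣ℕ =
  Polish.isPolish (FV.em₀ em) I↣ℕ M↣ℕ ,
  λ n E isEq (φ , E⇔φ) → Smoothness.smooth em M n I↣ℕ M↣ℕ isEq φ (FV.determined em I M φ) E⇔φ
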